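{- For every integer $n\geqslant 5$, the graph $A_n$ is $d$-balanced, i.e. $\gamma_{bd}(A_n)=0$.
   Context: For a simple undirected finite graph $G$ and $v\in V(G)$, the closed neighborhood is $N_G[v]=\{u\in V(G): uv\in E(G)\}\cup\{v\}$. A function $f\colon V(G)\to\{ -1,0,1\}$ is a balanced domination function (BDF) on $G$ if $\sum_{u\in N_G[v]} f(u)=0$ for every $v\in V(G)$. Its weight is $\omega_f=\sum_{v\in V(G)} f(v)$. The balanced domination number $\gamma_{bd}(G)$ is the maximum of $\omega_f$ over all BDFs $f$ on $G$. The graph $G$ is called $d$-balanced if $\gamma_{bd}(G)=0$. For $n\geqslant 5$, the convex polytope graph (antiprism) $A_n$ is the simple undirected graph with vertex set $V(A_n)=\{u_i,v_i,w_i \mid 0\leqslant i\leqslant n-1\}$ ($3n$ distinct vertices) and edge set $E(A_n)=\{u_iu_{i+1},\ v_iv_{i+1},\ w_iw_{i+1},\ u_iv_i,\ v_iw_i,\ u_{i+1}v_i,\ v_{i+1}w_i \mid 0\leqslant i\leqslant n-1\}$, where indices are taken modulo $n$. -}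

module Defs where

open import Data.Bool using (if_then_else_)
open import Data.Fin using (Fin; toℕ; splitAt; join)
open import Data.Fin.Properties using (_≟_; nonZeroIndex; splitAt-join; join-splitAt; toℕ-fromℕ<; toℕ<n)
open import Data.Integer using (ℤ; 0ℤ; 1ℤ; -1ℤ; _≤_)
open import Data.Integer.Properties using (+-0-commutativeMonoid; ≤-antisym)
open import Data.Nat as ℕ using (ℕ; suc)
import Data.Nat.Properties as ℕ
open import Data.Nat.DivMod using (_mod_; _%_; m<n⇒m%n≡m; n%n≡0; m%n<n)
open import Data.Product using (∃-syntax; _×_; _,_)
open import Data.Sum using (_⊎_; inj₁; inj₂; swap; [_,_]′)
open import Function using (_∘_)
open import Function.Bundles using (_↔_; Inverse; mk↔ₛ′)
open import Function.Properties.Inverse using (↔⇒↣)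
open import Relation.Binary using (Rel; Decidable; DecidableEquality; Irreflexive; Symmetric)
open import Relation.Binary.PropositionalEquality
open import Relation.Nullary using (¬_; Dec; yes; no; does)
open import Relation.Nullary.Decidable using (_⊎-dec_; via-injection)
import Relation.Unary as U
open import Level using (0ℓ)

open import Algebra.Properties.CommutativeMonoid.Sum +-0-commutativeMonoid using (sum)

record Graph : Set₁ where
  field
    V          : Set
    order      : ℕ
    finite     : V ↔ Fin order
    Adj        : Rel V 0ℓ
    adj?       : Decidable Adj
    adj-sym    : Symmetric Adj
    adj-irrefl : Irreflexive _≡_ Adj

  _≟V_ : DecidableEquality V
  _≟V_ = via-injection (↔⇒↣ finite) _≟_

  N[_] : V → U.Pred V 0ℓ
  N[ v ] u = Adj u v ⊎ u ≡ v

  N[_]? : ∀ v → U.Decidable N[ v ]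
  N[ v ]? u = adj? u v ⊎-dec (u ≟V v)

  ∑V : (V → ℤ) → ℤ
  ∑V f = sum (f ∘ Inverse.from finite)

  ∑⟨_⟩ : ∀ {P : U.Pred V 0ℓ} → U.Decidable P → (V → ℤ) → ℤ
  ∑⟨ P? ⟩ f = ∑V λ u → if does (P? u) then f u else 0ℤ

module _ (G : Graph) where
  open Graph G

  record IsBDF (f : V → ℤ) : Set where
    field
      values   : ∀ v → f v ≡ -1ℤ ⊎ f v ≡ 0ℤ ⊎ f v ≡ 1ℤ
      balanced : ∀ v → ∑⟨ N[ v ]? ⟩ f ≡ 0ℤ

  weight : (V → ℤ) → ℤ
  weight f = ∑V f

  -- γbd(G) = k, where γbd(G) is the maximum of the set of weights of BDFs.
  γbd≡ : ℤ → Set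
  γbd≡ k = (∃[ f ] IsBDF f × weight f ≡ k) × (∀ f → IsBDF f → weight f ≤ k)

  γbd-unique : ∀ {k l} → γbd≡ k → γbd≡ l → k ≡ l
  γbd-unique ((f , bf , refl) , maxf) ((g , bg , refl) , maxg) =
    ≤-antisym (maxg f bf) (maxf g bg)

  DBalanced : Set
  DBalanced = γbd≡ 0ℤ

data Vertex (n : ℕ) : Set where
  u v w : Fin n → Vertex n

vertex↔ : ∀ n → Vertex n ↔ Fin (n ℕ.+ (n ℕ.+ n))
vertex↔ n = mk↔ₛ′ to from to∘from from∘to
  where
  to : Vertex n → Fin (n ℕ.+ (n ℕ.+ n))
  to (u i) = join n (n ℕ.+ n) (inj₁ i)
  to (v i) = join n (n ℕ.+ n) (inj₂ (join n n (inj₁ i)))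
  to (w i) = join n (n ℕ.+ n) (inj₂ (join n n (inj₂ i)))

  from : Fin (n ℕ.+ (n ℕ.+ n)) → Vertex n
  from k = [ u , [ v , w ]′ ∘ splitAt n ]′ (splitAt n k)

  to∘from : ∀ k → to (from k) ≡ k
  to∘from k with splitAt n k | join-splitAt n (n ℕ.+ n) k
  ... | inj₁ _ | eq = eq
  ... | inj₂ l | eq with splitAt n l | join-splitAt n n l
  ...   | inj₁ _ | refl = eq
  ...   | inj₂ _ | refl = eq

  from∘to : ∀ x → from (to x) ≡ x
  from∘to (u i) rewrite splitAt-join n (n ℕ.+ n) (inj₁ i) = refl
  from∘to (v i) rewrite splitAt-join n (n ℕ.+ n) (inj₂ (join n n (inj₁ i)))
                      | splitAt-join n n (inj₁ i) = refl
  from∘to (w i) rewrite splitAt-join n (n ℕ.+ n) (inj₂ (join n n (inj₂ i)))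
                      | splitAt-join n n (inj₂ i) = refl

next : ∀ {n} → Fin n → Fin n
next {n} i = suc (toℕ i) mod n
  where instance _ = nonZeroIndex i

next≢ : ∀ {n} → 2 ℕ.≤ n → (i : Fin n) → next i ≢ i
next≢ {n} 2≤n i eq = go (ℕ.m≤n⇒m<n∨m≡n (toℕ<n i))
  where
  instance _ = nonZeroIndex i

  eqℕ : suc (toℕ i) % n ≡ toℕ i
  eqℕ = trans (sym (toℕ-fromℕ< (m%n<n (suc (toℕ i)) n))) (cong toℕ eq)

  go : ¬ (suc (toℕ i) ℕ.< n ⊎ suc (toℕ i) ≡ n)
  go (inj₁ lt) = ℕ.1+n≢n (trans (sym (m<n⇒m%n≡m lt)) eqℕ)
  go (inj₂ e)  = ℕ.<⇒≢ 2≤n (trans (cong suc 0≡i) e)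
    where
    0≡i : 0 ≡ toℕ i
    0≡i = trans (sym (n%n≡0 n)) (trans (cong (_% n) (sym e)) eqℕ)

-- One constructor per family of edges, in one orientation only; adjacency is the
-- symmetric closure.
data Edge {n : ℕ} : Rel (Vertex n) 0ℓ where
  uu  : ∀ i → Edge (u i) (u (next i))
  vv  : ∀ i → Edge (v i) (v (next i))
  ww  : ∀ i → Edge (w i) (w (next i))
  uv  : ∀ i → Edge (u i) (v i)
  vw  : ∀ i → Edge (v i) (w i)
  u⁺v : ∀ i → Edge (u (next i)) (v i)
  v⁺w : ∀ i → Edge (v (next i)) (w i)

edge? : ∀ {n} → Decidable (Edge {n})
edge? (u i) (u j) with next i ≟ j
... | yes refl = yes (uu i)
... | no  ¬p   = no λ { (uu _) → ¬p refl }
edge? (v i) (v j) with next i ≟ j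
... | yes refl = yes (vv i)
... | no  ¬p   = no λ { (vv _) → ¬p refl }
edge? (w i) (w j) with next i ≟ j
... | yes refl = yes (ww i)
... | no  ¬p   = no λ { (ww _) → ¬p refl }
edge? (u i) (v j) with i ≟ j | next j ≟ i
... | yes refl | _        = yes (uv i)
... | no  _    | yes refl = yes (u⁺v j)
... | no  ¬p   | no ¬q    = no λ { (uv _) → ¬p refl ; (u⁺v _) → ¬q refl }
edge? (v i) (w j) with i ≟ j | next j ≟ i
... | yes refl | _        = yes (vw i)
... | no  _    | yes refl = yes (v⁺w j)
... | no  ¬p   | no ¬q    = no λ { (vw _) → ¬p refl ; (v⁺w _) → ¬q refl }
edge? (u _) (w _) = no λ ()
edge? (v _) (u _) = no λ ()
edge? (w _) (u _) = no λ ()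
edge? (w _) (v _) = no λ ()

edge-irrefl : ∀ {n} → 2 ℕ.≤ n → Irreflexive _≡_ (Edge {n})
edge-irrefl 2≤n eq (uu i) = next≢ 2≤n i (sym (u-injective eq))
  where
  u-injective : ∀ {n} {i j : Fin n} → u i ≡ u j → i ≡ j
  u-injective refl = refl
edge-irrefl 2≤n eq (vv i) = next≢ 2≤n i (sym (v-injective eq))
  where
  v-injective : ∀ {n} {i j : Fin n} → v i ≡ v j → i ≡ j
  v-injective refl = refl
edge-irrefl 2≤n eq (ww i) = next≢ 2≤n i (sym (w-injective eq))
  where
  w-injective : ∀ {n} {i j : Fin n} → w i ≡ w j → i ≡ j
  w-injective refl = refl

antiprism : ∀ n → 5 ℕ.≤ n → Graph
antiprism n 5≤n = record
  { V          = Vertex n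
  ; order      = n ℕ.+ (n ℕ.+ n)
  ; finite     = vertex↔ n
  ; Adj        = λ x y → Edge x y ⊎ Edge y x
  ; adj?       = λ x y → edge? x y ⊎-dec edge? y x
  ; adj-sym    = swap
  ; adj-irrefl = λ eq → [ irr eq , irr (sym eq) ]′
  }
  where
  irr : Irreflexive _≡_ (Edge {n})
  irr = edge-irrefl (ℕ.≤-trans (ℕ.m≤m+n 2 3) 5≤n)

-- Give the vertices of the rows u, v, w the multipliers 1, -1, 1.  A closed
-- neighbourhood meets its own row in three vertices and each neighbouring row in
-- two, so its multipliers add up to 3 - 2 on the outer rows and to -3 + 2 + 2 on
-- the middle one, that is, always to 1.  Since y ∈ N[x] is symmetric, the weight
-- of f is therefore the combination of the vanishing sums ∑_{y ∈ N[x]} f(y) with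
-- these multipliers, so every balanced domination function has weight 0.
{-# OPTIONS --safe #-}
module Submission where

open import Defs
open import Data.Nat using (ℕ; _≤_)

open import Algebra.Properties.Semiring.Sum using (*-distribˡ-sum)
open import Data.Bool using (if_then_else_)
open import Data.Bool.Properties using (if-eta; if-float; if-cong)
open import Data.Fin using (Fin; zero; suc; toℕ; inject₁; fromℕ; _↑ˡ_; _↑ʳ_)
open import Data.Fin.Properties
  using (_≟_; toℕ-injective; toℕ-fromℕ<; toℕ-inject₁; toℕ-fromℕ; toℕ<n)
open import Data.Fin.Relation.Unary.Top using (view; ‵fromℕ; ‵inject₁)
open import Data.Integer using (ℤ; 0ℤ; 1ℤ; -1ℤ; _+_; _*_)
import Data.Integer.Properties as ℤ
open import Data.Nat using (zero; suc; s≤s; z≤n)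
import Data.Nat as ℕ
import Data.Nat.Properties as ℕ
open import Data.Nat.DivMod using (_%_; m<n⇒m%n≡m; n%n≡0; m%n<n)
open import Data.Product using (_×_; _,_)
open import Data.Sum using (_⊎_; inj₁; inj₂; map)
open import Function using (_∘_; _⇔_; mk⇔)
open import Function.Bundles using (Inverse)
open import Relation.Binary.PropositionalEquality
open import Relation.Nullary using (¬_; Dec; yes; no; does; contradiction)
open import Relation.Nullary.Decidable using (_⊎-dec_; does-⇔)

open import Algebra.Properties.CommutativeMonoid.Sum ℤ.+-0-commutativeMonoid
  using (sum; sum-cong-≗; sum-replicate-zero; sum-init-last; ∑-comm; ∑-distrib-+)

open ≡-Reasoning

-- Conditional terms and finite sums.

private
  variable
    P Q : Set

-- Spelled so that it unfolds to the summand of `∑⟨_⟩`.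
only-if : Dec P → ℤ → ℤ
only-if P? x = if does P? then x else 0ℤ

-- Only `does` enters the value, so membership decided by `N[_]?` can be traded for equations
-- between indices.
only-if-⇔ : P ⇔ Q → (P? : Dec P) (Q? : Dec Q) → ∀ x → only-if P? x ≡ only-if Q? x
only-if-⇔ P⇔Q P? Q? x = if-cong (does-⇔ P⇔Q P? Q?)

only-if-no : ¬ P → (P? : Dec P) → ∀ x → only-if P? x ≡ 0ℤ
only-if-no ¬p (yes p) x = contradiction p ¬p
only-if-no ¬p (no _)  x = refl

only-if-⊎ : ¬ (P × Q) → (P? : Dec P) (Q? : Dec Q) →
            ∀ x → only-if (P? ⊎-dec Q?) x ≡ only-if P? x + only-if Q? x
only-if-⊎ ¬pq (yes p) (yes q) x = contradiction (p , q) ¬pq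
only-if-⊎ ¬pq (yes p) (no _)  x = sym (ℤ.+-identityʳ x)
only-if-⊎ ¬pq (no _)  Q?      x = sym (ℤ.+-identityˡ _)

*-only-if : (P? : Dec P) → ∀ x y → x * only-if P? y ≡ only-if P? (x * y)
*-only-if P? x y = trans (if-float (x *_) (does P?)) (cong (if does P? then x * y else_) (ℤ.*-zeroʳ x))

sum-zero : ∀ {n} (f : Fin n → ℤ) → (∀ i → f i ≡ 0ℤ) → sum f ≡ 0ℤ
sum-zero {n} f f≗0 = trans (sum-cong-≗ f≗0) (sum-replicate-zero n)

sum-splitAt : ∀ m {n} (f : Fin (m ℕ.+ n) → ℤ) →
              sum f ≡ sum (λ i → f (i ↑ˡ n)) + sum (λ j → f (m ↑ʳ j))
sum-splitAt zero    f = sym (ℤ.+-identityˡ _)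
sum-splitAt (suc m) f =
  trans (cong (f zero +_) (sum-splitAt m (f ∘ suc))) (sym (ℤ.+-assoc (f zero) _ _))

sum-point : ∀ {n} (i : Fin n) x → sum (λ j → only-if (j ≟ i) x) ≡ x
sum-point {suc n} zero x =
  trans (cong (x +_) (sum-replicate-zero n)) (ℤ.+-identityʳ x)
sum-point (suc i) x = trans (ℤ.+-identityˡ _)
  (trans (sum-cong-≗ λ j → only-if-⇔ (mk⇔ (λ { refl → refl }) (cong suc))
                                      (suc j ≟ suc i) (j ≟ i) x)
         (sum-point i x))

-- Double counting over closed neighbourhoods.

module _ (G : Graph) where
  open Graph G

  N-sym : ∀ {x y} → N[ x ] y → N[ y ] x
  N-sym = map adj-sym sym

  -- With M the adjacency matrix plus the identity, Mg = 1 and Mf = 0. As M is symmetric, the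
  -- weight, which is the inner product of `f` with Mg, equals that of Mf with `g`.
  balanced⇒weight≡0 : (g : V → ℤ) → (∀ y → ∑⟨ N[ y ]? ⟩ g ≡ 1ℤ) →
                      ∀ {f} → IsBDF G f → weight G f ≡ 0ℤ
  balanced⇒weight≡0 g ∑g≡1 {f} bdf = begin
    ∑V f
      ≡⟨ sum-cong-≗ (λ i → trans (cong (f (from i) *_) (∑g≡1 (from i))) (ℤ.*-identityʳ (f (from i)))) ⟨
    ∑V (λ y → f y * ∑⟨ N[ y ]? ⟩ g)
      ≡⟨ sum-cong-≗ (λ i → *-∑⟨⟩ (f (from i)) (from i) g) ⟩
    ∑V (λ y → ∑⟨ N[ y ]? ⟩ (λ x → f y * g x))
      ≡⟨ ∑-comm (λ i j → only-if (N[ from i ]? (from j)) (f (from i) * g (from j))) ⟩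
    ∑V (λ x → ∑V (λ y → only-if (N[ y ]? x) (f y * g x)))
      -- After the swap the inner sum runs over the `y` whose closed neighbourhood contains `x`; by
      -- `N-sym` these are the members of `N[ x ]`.
      ≡⟨ sum-cong-≗ (λ i → sum-cong-≗ (λ j → exchange (from i) (from j))) ⟩
    ∑V (λ x → ∑⟨ N[ x ]? ⟩ (λ y → g x * f y))
      ≡⟨ sum-cong-≗ (λ i → *-∑⟨⟩ (g (from i)) (from i) f) ⟨
    ∑V (λ x → g x * ∑⟨ N[ x ]? ⟩ f)
      ≡⟨ sum-zero _ (λ i → trans (cong (g (from i) *_) (IsBDF.balanced bdf (from i)))
                                 (ℤ.*-zeroʳ (g (from i)))) ⟩
    0ℤ ∎
    where
    open Inverse finite using (from)

    *-∑⟨⟩ : ∀ c x h → c * ∑⟨ N[ x ]? ⟩ h ≡ ∑⟨ N[ x ]? ⟩ (λ y → c * h y)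
    *-∑⟨⟩ c x h = trans (*-distribˡ-sum ℤ.+-*-semiring c (λ i → only-if (N[ x ]? (from i)) (h (from i))))
                        (sum-cong-≗ λ i → *-only-if (N[ x ]? (from i)) c (h (from i)))

    exchange : ∀ x y → only-if (N[ y ]? x) (f y * g x) ≡ only-if (N[ x ]? y) (g x * f y)
    exchange x y = trans (only-if-⇔ (mk⇔ N-sym N-sym) (N[ y ]? x) (N[ x ]? y) (f y * g x))
                         (cong (only-if (N[ x ]? y)) (ℤ.*-comm (f y) (g x)))

  zero-isBDF : IsBDF G (λ _ → 0ℤ)
  zero-isBDF = record
    { values   = λ _ → inj₂ (inj₁ refl)
    ; balanced = λ x → sum-zero _ λ i → if-eta (does (N[ x ]? (Inverse.from finite i)))
    }

  multiplier⇒DBalanced : (g : V → ℤ) → (∀ y → ∑⟨ N[ y ]? ⟩ g ≡ 1ℤ) → DBalanced G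
  multiplier⇒DBalanced g ∑g≡1 =
    -- The zero function attains the maximum.
    (_ , zero-isBDF , sum-replicate-zero order) ,
    λ f bdf → ℤ.≤-reflexive (balanced⇒weight≡0 g ∑g≡1 bdf)

-- The cyclic successor on indices.

next-inject₁ : ∀ {m} (i : Fin m) → next (inject₁ i) ≡ suc i
next-inject₁ {m} i = toℕ-injective (begin
  toℕ (next (inject₁ i))           ≡⟨ toℕ-fromℕ< (m%n<n (suc (toℕ (inject₁ i))) (suc m)) ⟩
  suc (toℕ (inject₁ i)) % suc m    ≡⟨ cong (λ k → suc k % suc m) (toℕ-inject₁ i) ⟩
  suc (toℕ i) % suc m              ≡⟨ m<n⇒m%n≡m (s≤s (toℕ<n i)) ⟩
  suc (toℕ i)                      ∎)

next-fromℕ : ∀ m → next (fromℕ m) ≡ zero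
next-fromℕ m = toℕ-injective (begin
  toℕ (next (fromℕ m))        ≡⟨ toℕ-fromℕ< (m%n<n (suc (toℕ (fromℕ m))) (suc m)) ⟩
  suc (toℕ (fromℕ m)) % suc m ≡⟨ cong (λ k → suc k % suc m) (toℕ-fromℕ m) ⟩
  suc m % suc m               ≡⟨ n%n≡0 (suc m) ⟩
  0                           ∎)

-- Only the last index wraps around: split off, its term is `f zero`, and the others form the tail
-- of `sum f`.
sum-next : ∀ {n} (f : Fin n → ℤ) → sum (f ∘ next) ≡ sum f
sum-next {zero}  f = refl
sum-next {suc m} f = begin
  sum (f ∘ next)                                   ≡⟨ sum-init-last (f ∘ next) ⟩
  sum (f ∘ next ∘ inject₁) + f (next (fromℕ m))
    ≡⟨ cong₂ _+_ (sum-cong-≗ (cong f ∘ next-inject₁)) (cong f (next-fromℕ m)) ⟩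
  sum (f ∘ suc) + f zero                           ≡⟨ ℤ.+-comm (sum (f ∘ suc)) (f zero) ⟩
  sum f                                            ∎

-- Keeps the successor and the predecessor of an index apart, so that a vertex has two distinct
-- neighbours in its own row.
next²≢ : ∀ {n} → 3 ≤ n → (i : Fin n) → next (next i) ≢ i
next²≢ {suc (suc (suc k))} (s≤s (s≤s (s≤s z≤n))) i eq with view i
-- From the last index two steps lead to 1, which is not last because `n` is at least 3.
... | ‵fromℕ = contradiction (trans (sym next²-last) eq) λ ()
  where
  next²-last : next (next (fromℕ (suc (suc k)))) ≡ suc zero
  next²-last = trans (cong next (next-fromℕ (suc (suc k)))) (next-inject₁ zero)
... | ‵inject₁ j with view j | trans (cong next (sym (next-inject₁ j))) eq
-- From the last but one index two steps lead to `zero`, while that index is positive, again because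
-- `n` is at least 3.
...   | ‵fromℕ     | e = contradiction (trans (sym (next-fromℕ (suc (suc k)))) e) λ ()
-- Elsewhere nothing wraps, and two steps add 2.
...   | ‵inject₁ l | e = ℕ.<⇒≢ (ℕ.m<n+m (toℕ l) (s≤s (z≤n {1}))) (sym (begin
  suc (suc (toℕ l))                ≡⟨ cong toℕ (next-inject₁ (suc l)) ⟨
  toℕ (next (suc (inject₁ l)))     ≡⟨ cong toℕ e ⟩
  toℕ (inject₁ (inject₁ l))        ≡⟨ toℕ-inject₁ (inject₁ l) ⟩
  toℕ (inject₁ l)                  ≡⟨ toℕ-inject₁ l ⟩
  toℕ l                            ∎))

-- Sums over an index and its cyclic neighbours.

module _ {n} (2≤n : 2 ≤ n) (i : Fin n) (x : ℤ) where

  -- The predecessor of `i` is described implicitly by `next j ≡ i`; shift invariance accounts for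
  -- exactly one such `j`.
  sum-next-point : sum (λ j → only-if (next j ≟ i) x) ≡ x
  sum-next-point = trans (sum-next (λ j → only-if (j ≟ i) x)) (sum-point i x)

  sum-point-next : sum (λ j → only-if (j ≟ i ⊎-dec j ≟ next i) x) ≡ x + x
  sum-point-next = begin
    sum (λ j → only-if (j ≟ i ⊎-dec j ≟ next i) x)
      ≡⟨ sum-cong-≗ (λ j → only-if-⊎ (λ { (refl , e) → next≢ 2≤n i (sym e) }) (j ≟ i) (j ≟ next i) x) ⟩
    sum (λ j → only-if (j ≟ i) x + only-if (j ≟ next i) x)
      ≡⟨ ∑-distrib-+ (λ j → only-if (j ≟ i) x) (λ j → only-if (j ≟ next i) x) ⟩
    sum (λ j → only-if (j ≟ i) x) + sum (λ j → only-if (j ≟ next i) x)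
      ≡⟨ cong₂ _+_ (sum-point i x) (sum-point (next i) x) ⟩
    x + x ∎

  sum-point-prev : sum (λ j → only-if (j ≟ i ⊎-dec next j ≟ i) x) ≡ x + x
  sum-point-prev = begin
    sum (λ j → only-if (j ≟ i ⊎-dec next j ≟ i) x)
      ≡⟨ sum-cong-≗ (λ j → only-if-⊎ (λ { (refl , e) → next≢ 2≤n i e }) (j ≟ i) (next j ≟ i) x) ⟩
    sum (λ j → only-if (j ≟ i) x + only-if (next j ≟ i) x)
      ≡⟨ ∑-distrib-+ (λ j → only-if (j ≟ i) x) (λ j → only-if (next j ≟ i) x) ⟩
    sum (λ j → only-if (j ≟ i) x) + sum (λ j → only-if (next j ≟ i) x)
      ≡⟨ cong₂ _+_ (sum-point i x) sum-next-point ⟩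
    x + x ∎

sum-point-next-prev : ∀ {n} → 3 ≤ n → (i : Fin n) → ∀ x →
  sum (λ j → only-if ((j ≟ i ⊎-dec j ≟ next i) ⊎-dec next j ≟ i) x) ≡ x + x + x
sum-point-next-prev 3≤n i x = begin
  sum (λ j → only-if ((j ≟ i ⊎-dec j ≟ next i) ⊎-dec next j ≟ i) x)
    ≡⟨ sum-cong-≗ (λ j → only-if-⊎ disjoint (j ≟ i ⊎-dec j ≟ next i) (next j ≟ i) x) ⟩
  sum (λ j → only-if (j ≟ i ⊎-dec j ≟ next i) x + only-if (next j ≟ i) x)
    ≡⟨ ∑-distrib-+ (λ j → only-if (j ≟ i ⊎-dec j ≟ next i) x) (λ j → only-if (next j ≟ i) x) ⟩
  sum (λ j → only-if (j ≟ i ⊎-dec j ≟ next i) x) + sum (λ j → only-if (next j ≟ i) x)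
    ≡⟨ cong₂ _+_ (sum-point-next 2≤n i x) (sum-next-point 2≤n i x) ⟩
  x + x + x ∎
  where
  2≤n = ℕ.<⇒≤ 3≤n

  disjoint : ∀ {j} → ¬ ((j ≡ i ⊎ j ≡ next i) × next j ≡ i)
  disjoint (inj₁ refl , e) = next≢ 2≤n i e
  disjoint (inj₂ refl , e) = next²≢ 3≤n i e

-- Row sums in the antiprism.

module _ {n} (5≤n : 5 ≤ n) where
  open Graph (antiprism n 5≤n)

  ∑V-rows : ∀ f → ∑V f ≡ sum (f ∘ u) + (sum (f ∘ v) + sum (f ∘ w))
  ∑V-rows f = begin
    sum (f ∘ from)
      ≡⟨ sum-splitAt n (f ∘ from) ⟩
    sum {n} (λ i → f (from (i ↑ˡ (n ℕ.+ n)))) + sum (λ k → f (from (n ↑ʳ k)))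
      -- By computation of `join`, `i ↑ˡ (n + n)` is the code of `u i`; likewise for the other rows
      -- below.
      ≡⟨ cong₂ _+_ (sum-cong-≗ λ i → cong f (strictlyInverseʳ (u i)))
                   (sum-splitAt n (λ k → f (from (n ↑ʳ k)))) ⟩
    sum (f ∘ u) + (sum {n} (λ i → f (from (n ↑ʳ (i ↑ˡ n)))) + sum (λ i → f (from (n ↑ʳ (n ↑ʳ i)))))
      ≡⟨ cong (sum (f ∘ u) +_) (cong₂ _+_ (sum-cong-≗ λ i → cong f (strictlyInverseʳ (v i)))
                                          (sum-cong-≗ λ i → cong f (strictlyInverseʳ (w i)))) ⟩
    sum (f ∘ u) + (sum (f ∘ v) + sum (f ∘ w)) ∎
    where open Inverse finite using (from; strictlyInverseʳ)

  multiplier : Vertex n → ℤ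
  multiplier (u _) = 1ℤ
  multiplier (v _) = -1ℤ
  multiplier (w _) = 1ℤ

  private
    3≤n : 3 ≤ n
    3≤n = ℕ.≤-trans (ℕ.m≤m+n 3 2) 5≤n

    2≤n : 2 ≤ n
    2≤n = ℕ.<⇒≤ 3≤n

  -- The multiplier is a constant `c` along each row, so a row contributes `c` times the number of
  -- its vertices in `N[ y ]`.
  module _ (y : Vertex n) (row : Fin n → Vertex n) (i : Fin n) (c : ℤ) where

    row-none : (∀ j → ¬ N[ y ] (row j)) → sum (λ j → only-if (N[ y ]? (row j)) c) ≡ 0ℤ
    row-none none = sum-zero _ λ j → only-if-no (none j) (N[ y ]? (row j)) c

    row-next : (∀ j → N[ y ] (row j) ⇔ (j ≡ i ⊎ j ≡ next i)) →
               sum (λ j → only-if (N[ y ]? (row j)) c) ≡ c + c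
    row-next iff = trans (sum-cong-≗ λ j → only-if-⇔ (iff j) (N[ y ]? (row j)) (j ≟ i ⊎-dec j ≟ next i) c)
                         (sum-point-next 2≤n i c)

    row-prev : (∀ j → N[ y ] (row j) ⇔ (j ≡ i ⊎ next j ≡ i)) →
               sum (λ j → only-if (N[ y ]? (row j)) c) ≡ c + c
    row-prev iff = trans (sum-cong-≗ λ j → only-if-⇔ (iff j) (N[ y ]? (row j)) (j ≟ i ⊎-dec next j ≟ i) c)
                         (sum-point-prev 2≤n i c)

    row-own : (∀ j → N[ y ] (row j) ⇔ ((j ≡ i ⊎ j ≡ next i) ⊎ next j ≡ i)) →
              sum (λ j → only-if (N[ y ]? (row j)) c) ≡ c + c + c
    row-own iff = trans (sum-cong-≗ λ j →
                          only-if-⇔ (iff j) (N[ y ]? (row j)) ((j ≟ i ⊎-dec j ≟ next i) ⊎-dec next j ≟ i) c)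
                        (sum-point-next-prev 3≤n i c)

  ∑-multiplier≡1 : ∀ y → ∑⟨ N[ y ]? ⟩ multiplier ≡ 1ℤ
  ∑-multiplier≡1 y = trans (∑V-rows λ x → only-if (N[ y ]? x) (multiplier x)) (rows y)
    where
    rows : ∀ y → sum (λ j → only-if (N[ y ]? (u j)) 1ℤ) +
                 (sum (λ j → only-if (N[ y ]? (v j)) -1ℤ) +
                  sum (λ j → only-if (N[ y ]? (w j)) 1ℤ)) ≡ 1ℤ
    -- The row totals are closed integers, so the right-hand sides evaluate to `1ℤ`: 3 - 2 + 0 here,
    -- then 2 - 3 + 2 and 0 - 2 + 3.
    rows (u i) = cong₂ _+_
      (row-own (u i) u i 1ℤ λ j → mk⇔
        (λ { (inj₁ (inj₁ (uu _))) → inj₂ refl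
           ; (inj₁ (inj₂ (uu _))) → inj₁ (inj₂ refl)
           ; (inj₂ refl)          → inj₁ (inj₁ refl) })
        (λ { (inj₁ (inj₁ refl)) → inj₂ refl
           ; (inj₁ (inj₂ refl)) → inj₁ (inj₂ (uu _))
           ; (inj₂ refl)        → inj₁ (inj₁ (uu _)) }))
      (cong₂ _+_
        -- The edges `u⁺v` and `v⁺w` raise the index in the earlier row, so a vertex meets the
        -- following row at `i` and its predecessor, and the preceding row at `i` and `next i`.
        (row-prev (u i) v i -1ℤ λ j → mk⇔
          (λ { (inj₁ (inj₂ (uv _))) → inj₁ refl ; (inj₁ (inj₂ (u⁺v _))) → inj₂ refl })
          (λ { (inj₁ refl) → inj₁ (inj₂ (uv _)) ; (inj₂ refl) → inj₁ (inj₂ (u⁺v _)) }))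
        (row-none (u i) w i 1ℤ λ { j (inj₁ (inj₁ ())) ; j (inj₁ (inj₂ ())) ; j (inj₂ ()) }))
    rows (v i) = cong₂ _+_
      (row-next (v i) u i 1ℤ λ j → mk⇔
        (λ { (inj₁ (inj₁ (uv _))) → inj₁ refl ; (inj₁ (inj₁ (u⁺v _))) → inj₂ refl })
        (λ { (inj₁ refl) → inj₁ (inj₁ (uv _)) ; (inj₂ refl) → inj₁ (inj₁ (u⁺v _)) }))
      (cong₂ _+_
        (row-own (v i) v i -1ℤ λ j → mk⇔
          (λ { (inj₁ (inj₁ (vv _))) → inj₂ refl
             ; (inj₁ (inj₂ (vv _))) → inj₁ (inj₂ refl)
             ; (inj₂ refl)          → inj₁ (inj₁ refl) })
          (λ { (inj₁ (inj₁ refl)) → inj₂ refl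
             ; (inj₁ (inj₂ refl)) → inj₁ (inj₂ (vv _))
             ; (inj₂ refl)        → inj₁ (inj₁ (vv _)) }))
        (row-prev (v i) w i 1ℤ λ j → mk⇔
          (λ { (inj₁ (inj₂ (vw _))) → inj₁ refl ; (inj₁ (inj₂ (v⁺w _))) → inj₂ refl })
          (λ { (inj₁ refl) → inj₁ (inj₂ (vw _)) ; (inj₂ refl) → inj₁ (inj₂ (v⁺w _)) })))
    rows (w i) = cong₂ _+_
      (row-none (w i) u i 1ℤ λ { j (inj₁ (inj₁ ())) ; j (inj₁ (inj₂ ())) ; j (inj₂ ()) })
      (cong₂ _+_
        (row-next (w i) v i -1ℤ λ j → mk⇔
          (λ { (inj₁ (inj₁ (vw _))) → inj₁ refl ; (inj₁ (inj₁ (v⁺w _))) → inj₂ refl })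
          (λ { (inj₁ refl) → inj₁ (inj₁ (vw _)) ; (inj₂ refl) → inj₁ (inj₁ (v⁺w _)) }))
        (row-own (w i) w i 1ℤ λ j → mk⇔
          (λ { (inj₁ (inj₁ (ww _))) → inj₂ refl
             ; (inj₁ (inj₂ (ww _))) → inj₁ (inj₂ refl)
             ; (inj₂ refl)          → inj₁ (inj₁ refl) })
          (λ { (inj₁ (inj₁ refl)) → inj₂ refl
             ; (inj₁ (inj₂ refl)) → inj₁ (inj₂ (ww _))
             ; (inj₂ refl)        → inj₁ (inj₁ (ww _)) })))

theorem1 : (n : ℕ) (5≤n : 5 ≤ n) → DBalanced (antiprism n 5≤n)
theorem1 n 5≤n = multiplier⇒DBalanced (antiprism n 5≤n) (multiplier 5≤n) (∑-multiplier≡1 5≤n)
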